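{- The only pair $(n,x)$ of positive integers with $n\geq 2$ satisfying $(10^{n}-2)(58^{n}-2)=x^{2}$ is $(n,x)=(2,574)$. -}

module Defs where

{-# OPTIONS --safe #-}
-- Odd n are excluded modulo 5, 7, 11 and 31: from exponent 1 on, the powers of 10 and 58
-- modulo each of these primes have period dividing 60.
--
-- For n = 2m, put D = 4^m, W = 5^m and V = 29^m, so that (D W² - 2)(D V² - 2) is a
-- square. Values A, B for which (D A² - 2)(D B² - 2) is a square belong to the same
-- Pell equation D A² - e u² = 2, and multiplying by the unit (A √D - u √e)² / 2 replaces
-- the larger of A and B by a smaller value while keeping gcd(A, B). Since W and V are
-- coprime, this Euclidean algorithm ends at A = B = 1, so (D W² - 2)(D - 2) is a square.
-- One more reduction of the pair (1, W) gives 0 < k < W with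
-- k² + W² + 2(D - 2) = 2(D - 1) W k, hence k is about 5^m / (2 · 4^m) and W divides
-- k² + 2D - 4. For m ≥ 4 the latter lies strictly between 0 and W. The cases m = 2 and
-- m = 3 are excluded by the congruences again.
module Submission where

open import Data.Product.Base using (∃; _×_; _,_; proj₁)
open import Data.Sum.Base using (_⊎_; inj₁; inj₂)
open import Relation.Binary.Definitions using (tri<; tri≈; tri>)
open import Relation.Binary.PropositionalEquality
open import Relation.Nullary using (¬_; Dec; yes; no; ¬?; contradiction)
open import Relation.Nullary.Decidable using (from-yes; _×-dec_; _⊎-dec_; _→-dec_)
open import Function.Bundles using (_⇔_; mk⇔)

module Naturals where
  open import Data.Nat.Base
  open import Data.Nat.Divisibility using (divides)
  open import Data.Nat.DivMod using
    (%-distribˡ-+; %-distribˡ-*; m%n%n≡m%n; m%n<n; m≡m%n+[m/n]*n; m*n%n≡0; m∣n⇒o%n%m≡o%m)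
  open import Data.Nat.Properties
  open import Data.Nat.Tactic.RingSolver using (solve-∀)

  -- Congruences and periodicity of powers.

  +-cong-% : ∀ p .{{_ : NonZero p}} {a a′ b b′} → a % p ≡ a′ % p → b % p ≡ b′ % p →
    (a + b) % p ≡ (a′ + b′) % p
  +-cong-% p {a} {a′} {b} {b′} eq₁ eq₂ = begin
    (a + b) % p             ≡⟨ %-distribˡ-+ a b p ⟩
    (a % p + b % p) % p     ≡⟨ cong₂ (λ u v → (u + v) % p) eq₁ eq₂ ⟩
    (a′ % p + b′ % p) % p   ≡⟨ %-distribˡ-+ a′ b′ p ⟨
    (a′ + b′) % p           ∎
    where open ≡-Reasoning

  *-cong-% : ∀ p .{{_ : NonZero p}} {a a′ b b′} → a % p ≡ a′ % p → b % p ≡ b′ % p →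
    (a * b) % p ≡ (a′ * b′) % p
  *-cong-% p {a} {a′} {b} {b′} eq₁ eq₂ = begin
    (a * b) % p               ≡⟨ %-distribˡ-* a b p ⟩
    (a % p * (b % p)) % p     ≡⟨ cong₂ (λ u v → (u * v) % p) eq₁ eq₂ ⟩
    (a′ % p * (b′ % p)) % p   ≡⟨ %-distribˡ-* a′ b′ p ⟨
    (a′ * b′) % p             ∎
    where open ≡-Reasoning

  ^-periodic-% : ∀ p .{{_ : NonZero p}} a l → (a ^ suc l) % p ≡ a % p →
    ∀ r q → (a ^ suc (r + q * l)) % p ≡ (a ^ suc r) % p
  ^-periodic-% p a l per r zero = cong (λ k → (a ^ suc k) % p) (+-identityʳ r)
  ^-periodic-% p a l per r (suc q) = begin
    (a ^ suc (r + (l + q * l))) % p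
      ≡⟨ cong (λ k → (a ^ k) % p) (shift r l (q * l)) ⟩
    (a ^ (suc l + (r + q * l))) % p
      ≡⟨ cong (_% p) (^-distribˡ-+-* a (suc l) (r + q * l)) ⟩
    (a ^ suc l * a ^ (r + q * l)) % p
      ≡⟨ *-cong-% p per refl ⟩
    (a ^ suc (r + q * l)) % p
      ≡⟨ ^-periodic-% p a l per r q ⟩
    (a ^ suc r) % p ∎
    where
    open ≡-Reasoning
    shift : ∀ r l s → suc (r + (l + s)) ≡ suc l + (r + s)
    shift = solve-∀

  -- The equation modulo 5, 7, 11 and 31.

  -- (10ⁿ - 2)(58ⁿ - 2) = x² modulo p, with the terms moved so that no subtraction occurs.
  SolutionMod : (p : ℕ) .{{_ : NonZero p}} → ℕ → ℕ → Set
  SolutionMod p n x =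
    (x * x + 2 * 10 ^ n + 2 * 58 ^ n) % p ≡ (10 ^ n * 58 ^ n + 4) % p

  SolvableMod : (p : ℕ) .{{_ : NonZero p}} → ℕ → Set
  SolvableMod p n = ∃ λ x → x < p × SolutionMod p n x

  solvableMod? : ∀ p .{{_ : NonZero p}} n → Dec (SolvableMod p n)
  solvableMod? p n = anyUpTo? (λ x → _ ≟ _) p

  reduce : ∀ p .{{_ : NonZero p}} → (10 ^ 61) % p ≡ 10 % p → (58 ^ 61) % p ≡ 58 % p →
    ∀ k x → SolutionMod p (suc k) x → SolvableMod p (suc (k % 60))
  reduce p per₁ per₂ k x sol = x % p , m%n<n x p , (begin
    _   ≡⟨ +-cong-% p (+-cong-% p (*-cong-% p x≡x%p x≡x%p) (*-cong-% p {2} refl u)) (*-cong-% p {2} refl v) ⟨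
    _   ≡⟨ sol ⟩
    _   ≡⟨ +-cong-% p {b = 4} (*-cong-% p u v) refl ⟩
    _   ∎)
    where
    open ≡-Reasoning
    x≡x%p = sym (m%n%n≡m%n x p)
    power : ∀ a → (a ^ 61) % p ≡ a % p → (a ^ suc k) % p ≡ (a ^ suc (k % 60)) % p
    power a per = trans (cong (λ k → (a ^ suc k) % p) (m≡m%n+[m/n]*n k 60))
      (^-periodic-% p a 60 per (k % 60) (k / 60))
    u = power 10 per₁
    v = power 58 per₂

  -- The exponent is j + 1 modulo 60, shifted because the powers of 10 modulo 5 are periodic
  -- only from exponent 1 on; j = 3 and j = 5 stand for n = 4 and n = 6.
  Excluded : ℕ → Set
  Excluded j = j % 2 ≡ 0 ⊎ j ≡ 3 ⊎ j ≡ 5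

  excluded-unsolvable : ∀ {j} → j < 60 → Excluded j →
    ¬ (SolvableMod 5 (suc j) × SolvableMod 7 (suc j) × SolvableMod 11 (suc j) × SolvableMod 31 (suc j))
  excluded-unsolvable = from-yes (allUpTo? (λ j →
    ((j % 2 ≟ 0) ⊎-dec ((j ≟ 3) ⊎-dec (j ≟ 5))) →-dec
    ¬? (solvableMod? 5 (suc j) ×-dec (solvableMod? 7 (suc j) ×-dec
      (solvableMod? 11 (suc j) ×-dec solvableMod? 31 (suc j))))) 60)

  Solution : ℕ → ℕ → Set
  Solution n x = x * x + 2 * 10 ^ n + 2 * 58 ^ n ≡ 10 ^ n * 58 ^ n + 4

  excluded-¬Solution : ∀ k x → Excluded (k % 60) → ¬ Solution (suc k) x
  excluded-¬Solution k x exc sol = excluded-unsolvable (m%n<n k 60) exc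
    ( reduce 5 refl refl k x (cong (_% 5) sol)
    , reduce 7 refl refl k x (cong (_% 7) sol)
    , reduce 11 refl refl k x (cong (_% 11) sol)
    , reduce 31 refl refl k x (cong (_% 31) sol))

  odd-¬Solution : ∀ m x → ¬ Solution (suc (m * 2)) x
  -- An odd exponent `j + 1` has even `j`, and reduction modulo 60 keeps the parity.
  odd-¬Solution m x = excluded-¬Solution (m * 2) x
    (inj₁ (trans (m∣n⇒o%n%m≡o%m 2 60 (m * 2) (divides 30 refl)) (m*n%n≡0 m 2)))

  -- Size estimates for the final quadratic.

  -- Applied with E = 2^m and W = 5^m, where D = E².
  small-root-absurd : ∀ E W k → 0 < k → k < W → 2 ≤ E →
    4 * W + 3 * E < 2 * (E * E) * E → 9 * (E * E) ≤ 4 * W →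
    k * k + W * W + 2 * (E * E) + 2 * W * k ≢ 2 * (E * E) * W * k + 4
  small-root-absurd E W@(suc _) k@(suc _) 0<k k<W 2≤E h₁ h₂ eq with 2 * k <? E
  -- By `eq′`, `X` is congruent to 4 modulo `W`, which is impossible for `4 < X < W`.
  ... | yes 2k<E = <-irrefl eq′ (begin-strict
      X + W * (W + 2 * k)   <⟨ +-monoˡ-< _ X<W ⟩
      W + W * (W + 2 * k)   ≡⟨ *-suc W (W + 2 * k) ⟨
      W * suc (W + 2 * k)   ≤⟨ *-monoʳ-≤ W (*-cancelˡ-< W _ _ W[W+2k]<W[2Dk]) ⟩
      W * (2 * D * k)       ≤⟨ m≤m+n _ 4 ⟩
      W * (2 * D * k) + 4   ∎)
    where
    open ≤-Reasoning
    D = E * E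
    X = k * k + 2 * D
    regroup : ∀ k W D → k * k + 2 * D + W * (W + 2 * k)
      ≡ k * k + W * W + 2 * D + 2 * W * k
    regroup = solve-∀
    regroup′ : ∀ k W D → 2 * D * W * k + 4 ≡ W * (2 * D * k) + 4
    regroup′ = solve-∀
    eq′ : X + W * (W + 2 * k) ≡ W * (2 * D * k) + 4
    eq′ = trans (regroup k W D) (trans eq (regroup′ k W D))
    4<X : 4 < X
    4<X = <-≤-trans (s≤s (m≤m+n 4 3)) (≤-trans (*-monoʳ-≤ 2 (*-mono-≤ 2≤E 2≤E)) (m≤n+m (2 * D) (k * k)))
    quadruple : ∀ k D → 4 * (k * k + 2 * D) ≡ 2 * k * (2 * k) + 8 * D
    quadruple = solve-∀
    X<W : X < W
    X<W = *-cancelˡ-< 4 X W (begin-strict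
      4 * X                     ≡⟨ quadruple k D ⟩
      2 * k * (2 * k) + 8 * D   <⟨ +-monoˡ-< (8 * D) (*-mono-< 2k<E 2k<E) ⟩
      9 * D                     ≤⟨ h₂ ⟩
      4 * W                     ∎)
    W[W+2k]<W[2Dk] : W * (W + 2 * k) < W * (2 * D * k)
    W[W+2k]<W[2Dk] = +-cancelʳ-< 4 _ _ (begin-strict
      W * (W + 2 * k) + 4   <⟨ +-monoʳ-< (W * (W + 2 * k)) 4<X ⟩
      W * (W + 2 * k) + X   ≡⟨ +-comm _ X ⟩
      X + W * (W + 2 * k)   ≡⟨ eq′ ⟩
      W * (2 * D * k) + 4   ∎)
  -- Estimating `k * k` by `W * k` and `2 * D` by `W * W` lets `W` be cancelled from the equation.
  -- Multiplying the result by `E`, at most `2 * k`, contradicts `h₁`.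
  ... | no 2k≮E = <-irrefl refl (begin-strict
      2 * D * k * E                 ≤⟨ *-monoˡ-≤ E 2Dk≤2W+3k ⟩
      (2 * W + 3 * k) * E           ≡⟨ expand W k E ⟩
      2 * W * E + 3 * k * E         ≤⟨ +-monoˡ-≤ (3 * k * E) (*-monoʳ-≤ (2 * W) (≮⇒≥ 2k≮E)) ⟩
      2 * W * (2 * k) + 3 * k * E   ≡⟨ factor W k E ⟩
      k * (4 * W + 3 * E)           <⟨ *-monoʳ-< k h₁ ⟩
      k * (2 * D * E)               ≡⟨ commute k D E ⟩
      2 * D * k * E                 ∎)
    where
    open ≤-Reasoning
    D = E * E
    expand : ∀ W k E → (2 * W + 3 * k) * E ≡ 2 * W * E + 3 * k * E
    expand = solve-∀
    factor : ∀ W k E → 2 * W * (2 * k) + 3 * k * E ≡ k * (4 * W + 3 * E)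
    factor = solve-∀
    commute : ∀ k D E → k * (2 * D * E) ≡ 2 * D * k * E
    commute = solve-∀
    regroup : ∀ W k D → W * (2 * D * k) ≡ 2 * D * W * k
    regroup = solve-∀
    collect : ∀ W k → W * k + W * W + W * W + 2 * W * k ≡ W * (2 * W + 3 * k)
    collect = solve-∀
    8D≤4W : 4 * (2 * D) ≤ 4 * W
    8D≤4W = begin
      4 * (2 * D)   ≡⟨ *-assoc 4 2 D ⟨
      8 * D         ≤⟨ m≤n+m (8 * D) D ⟩
      9 * D         ≤⟨ h₂ ⟩
      4 * W         ∎
    2D≤W² : 2 * D ≤ W * W
    2D≤W² = ≤-trans (*-cancelˡ-≤ 4 8D≤4W) (m≤m*n W W)
    2Dk≤2W+3k : 2 * D * k ≤ 2 * W + 3 * k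
    2Dk≤2W+3k = *-cancelˡ-≤ W (begin
      W * (2 * D * k)     ≡⟨ regroup W k D ⟩
      2 * D * W * k       ≤⟨ m≤m+n _ 4 ⟩
      2 * D * W * k + 4   ≡⟨ eq ⟨
      k * k + W * W + 2 * D + 2 * W * k
        ≤⟨ +-monoˡ-≤ (2 * W * k) (+-mono-≤ (+-monoˡ-≤ (W * W) (*-monoˡ-≤ k (<⇒≤ k<W))) 2D≤W²) ⟩
      W * k + W * W + W * W + 2 * W * k
        ≡⟨ collect W k ⟩
      W * (2 * W + 3 * k)   ∎)

module Integers where
  open Naturals
  open import Data.Integer.Base hiding (suc)
  open import Data.Integer.Properties
  open import Data.Integer.Tactic.RingSolver using (solve-∀)
  open import Data.Nat.Base as ℕ using (ℕ; zero; suc)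
  import Data.Nat.Properties as ℕ
  import Data.Nat.Tactic.RingSolver as ℕ

  -- Signs and cancellation in the integers.

  *-pos : ∀ {i j} → 0ℤ < i → 0ℤ < j → 0ℤ < i * j
  *-pos {+[1+ _ ]} {+[1+ _ ]} _ _ = +<+ ℕ.z<s
  *-pos {+0} (+<+ ())
  *-pos {+[1+ _ ]} {+0} _ (+<+ ())

  *-nonNeg : ∀ {i j} → 0ℤ ≤ i → 0ℤ ≤ j → 0ℤ ≤ i * j
  *-nonNeg {+ m} {+ n} _ _ = subst (0ℤ ≤_) (pos-* m n) (+≤+ ℕ.z≤n)

  square-nonNeg : ∀ i → 0ℤ ≤ i * i
  square-nonNeg (+ m) = *-nonNeg {+ m} {+ m} (+≤+ ℕ.z≤n) (+≤+ ℕ.z≤n)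
  square-nonNeg -[1+ m ] = +≤+ ℕ.z≤n

  *-cancelˡ-pos : ∀ {i j} → 0ℤ < i → 0ℤ < i * j → 0ℤ < j
  *-cancelˡ-pos {i} {j} 0<i 0<ij =
    *-cancelˡ-<-nonNeg i {{nonNegative (<⇒≤ 0<i)}} (subst (_< i * j) (sym (*-zeroʳ i)) 0<ij)

  i<j⇒0<j-i : ∀ {i j} → i < j → 0ℤ < j - i
  i<j⇒0<j-i {i} {j} i<j = subst (_< j - i) (+-inverseʳ i) (+-monoˡ-< (- i) i<j)

  neg-square : ∀ i → - i * - i ≡ i * i
  neg-square = solve-∀

  -- How a hypothesis enters a ring identity: the solver proves `i + k ≡ j + l` unconditionally, and
  -- `k ≡ l` is a multiple of the hypothesis.
  +-cancel : ∀ {i j k l} → i + k ≡ j + l → k ≡ l → i ≡ j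
  +-cancel {i} {j} {k} p refl = begin
    i           ≡⟨ cancel i k ⟨
    i + k - k   ≡⟨ cong (_- k) p ⟩
    j + k - k   ≡⟨ cancel j k ⟩
    j           ∎
    where
    open ≡-Reasoning
    cancel : ∀ i k → i + k - k ≡ i
    cancel = solve-∀

  -- The form D A² - 2 and its reflections.

  form : ℤ → ℤ → ℤ
  form D A = D * (A * A) - + 2

  -- The coefficient of √D in (B √D + v √e)(A √D - u √e)² / 2, where `form D A` = e u², `form D B` =
  -- e v² and x = e u v.
  reflect : ℤ → ℤ → ℤ → ℤ → ℤ
  reflect D A B x = B * (form D A + + 1) - A * x

  -- Makes positivity visible for D > 2 and A ≥ 1: the first summand is positive, the second
  -- nonnegative.
  form-expand : ∀ D A → (D - + 2) * (A * A) + + 2 * ((A - + 1) * (A + + 1)) ≡ D * (A * A) - + 2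
  form-expand = solve-∀

  form-pos : ∀ {D A} → + 2 < D → 0ℤ < A → 0ℤ < form D A
  form-pos {D} {A} 2<D 0<A = subst (0ℤ <_) (form-expand D A)
    (+-mono-<-≤ (*-pos (i<j⇒0<j-i 2<D) (*-pos 0<A 0<A))
      (*-nonNeg {+ 2} (+≤+ ℕ.z≤n)
        (*-nonNeg (i≤j⇒0≤j-i (i<j⇒suc[i]≤j 0<A)) (+-mono-≤ (<⇒≤ 0<A) (+≤+ ℕ.z≤n)))))

  reflect-quadratic′ : ∀ D A B x → let F = D * (A * A) - + 2; B′ = B * (F + + 1) - A * x in
    B′ * B′ + B * B + + 2 * (A * A) * F + A * A * (F * (D * (B * B) - + 2))
      ≡ + 2 * (F + + 1) * B * B′ + A * A * (x * x)
  reflect-quadratic′ = solve-∀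

  -- reflect D A B x and reflect D A B (- x) are the two roots of this quadratic in B′.
  reflect-quadratic : ∀ D A B x → x * x ≡ form D A * form D B →
    let B′ = reflect D A B x in
    B′ * B′ + B * B + + 2 * (A * A) * form D A ≡ + 2 * (form D A + + 1) * B * B′
  reflect-quadratic D A B x x² =
    +-cancel (reflect-quadratic′ D A B x) (cong (A * A *_) (sym x²))

  -- The left side of `reflect-quadratic` is positive, and on the right the factor of the root is
  -- positive.
  reflect-pos : ∀ {D A B} x → + 2 < D → 0ℤ < A → 0ℤ < B →
    x * x ≡ form D A * form D B → 0ℤ < reflect D A B x
  reflect-pos {D} {A} {B} x 2<D 0<A 0<B eq =
    *-cancelˡ-pos (*-pos (*-pos {+ 2} (+<+ ℕ.z<s) (+-mono-<-≤ (form-pos 2<D 0<A) (+≤+ ℕ.z≤n))) 0<B)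
      (subst (0ℤ <_) (reflect-quadratic D A B x eq)
        (+-mono-<-≤ (+-mono-≤-< (square-nonNeg (reflect D A B x)) (*-pos 0<B 0<B))
          (<⇒≤ (*-pos (*-pos {+ 2} (+<+ ℕ.z<s) (*-pos 0<A 0<A)) (form-pos 2<D 0<A)))))

  reflect-gap′ : ∀ D A B x → let F = D * (A * A) - + 2 in
    ((B * (F + + 1) - A * x) - B) * ((B * (F + + 1) - A * (- x)) - B)
      + + 2 * F * ((B - A) * (B + A)) + A * A * (x * x)
      ≡ 0ℤ + A * A * (F * (D * (B * B) - + 2))
  reflect-gap′ = solve-∀

  -- B lies strictly between the two roots, since the quadratic is negative at B.
  reflect-gap : ∀ D A B x → x * x ≡ form D A * form D B →
    (reflect D A B x - B) * (reflect D A B (- x) - B) + + 2 * form D A * ((B - A) * (B + A)) ≡ 0ℤ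
  reflect-gap D A B x x² = +-cancel (reflect-gap′ D A B x) (cong (A * A *_) x²)

  -- If both roots were at least `B`, the vanishing sum in `reflect-gap` would be a nonnegative
  -- product plus a positive term.
  reflect-< : ∀ {D A B} x → + 2 < D → 0ℤ < A → A < B →
    x * x ≡ form D A * form D B → reflect D A B x < B ⊎ reflect D A B (- x) < B
  reflect-< {D} {A} {B} x 2<D 0<A A<B eq with reflect D A B x <? B | reflect D A B (- x) <? B
  ... | yes p | _     = inj₁ p
  ... | no _  | yes q = inj₂ q
  ... | no p  | no q  = contradiction (sym (reflect-gap D A B x eq)) (<⇒≢
    (+-mono-≤-< (*-nonNeg (i≤j⇒0≤j-i (≮⇒≥ p)) (i≤j⇒0≤j-i (≮⇒≥ q)))
      (*-pos (*-pos {+ 2} (+<+ ℕ.z<s) (form-pos 2<D 0<A))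
        (*-pos (i<j⇒0<j-i A<B) (+-mono-<-≤ (<-trans 0<A A<B) (<⇒≤ 0<A))))))

  -- One step of the descent.

  -- With form D A = e u², form D B = e v² and N = e w², these are a = e w u, b = e w v and
  -- x = e u v. Carrying a and b along transports “N times form D A is a square” through the
  -- descent without dividing by common factors.
  record Linked (D N A B : ℤ) : Set where
    field
      a b x s t : ℤ
      a²  : a * a ≡ N * form D A
      b²  : b * b ≡ N * form D B
      x²  : x * x ≡ form D A * form D B
      ab  : a * b ≡ N * x
      bézout : s * A + t * B ≡ 1ℤ

  open Linked

  swap : ∀ {D N A B} → Linked D N A B → Linked D N B A
  swap {D} {N} {A} {B} L = record
    { a = b L ; b = a L ; x = x L ; s = t L ; t = s L
    ; a² = b² L ; b² = a² L
    ; x² = trans (x² L) (*-comm (form D A) (form D B))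
    ; ab = trans (*-comm (b L) (a L)) (ab L)
    ; bézout = trans (+-comm (t L * B) (s L * A)) (bézout L)
    }

  -- Replaces v by -v, so that `descend` reaches the other root.
  negate : ∀ {D N A B} → Linked D N A B → Linked D N A B
  negate {D} {N} {A} {B} L = record
    { a = a L ; b = - b L ; x = - x L ; s = s L ; t = t L
    ; a² = a² L ; b² = trans (neg-square (b L)) (b² L)
    ; x² = trans (neg-square (x L)) (x² L)
    ; ab = trans (sym (neg-distribʳ-* (a L) (b L))) (trans (cong -_ (ab L)) (neg-distribʳ-* N (x L)))
    ; bézout = bézout L
    }

  -- Isolates b², ab and a², so that the fields of `Linked` can replace them before `b′²-identity`
  -- applies; `ab′-expand` serves `ab′-identity` likewise.
  b′²-expand : ∀ T E a b →
    (b * T - E * a) * (b * T - E * a) ≡ b * b * (T * T) - + 2 * E * T * (a * b) + E * E * (a * a)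
  b′²-expand = solve-∀

  b′²-identity : ∀ D A B N x → let F = D * (A * A) - + 2; T = F + + 1; E = D * A * B; G = D * (B * B) - + 2 in
    N * G * (T * T) - + 2 * E * T * (N * x) + E * E * (N * F) + N * (D * (A * A * (x * x)))
      ≡ N * (D * ((B * T - A * x) * (B * T - A * x)) - + 2) + N * (D * (A * A * (F * G)))
  b′²-identity = solve-∀

  x′²-identity : ∀ D A B x → let F = D * (A * A) - + 2; T = F + + 1 in
    (x * T - D * A * B * F) * (x * T - D * A * B * F) + F * (D * (B * B) - + 2)
      ≡ F * (D * ((B * T - A * x) * (B * T - A * x)) - + 2) + x * x
  x′²-identity = solve-∀

  ab′-expand : ∀ T E a b → a * (b * T - E * a) ≡ a * b * T - E * (a * a)
  ab′-expand = solve-∀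

  ab′-identity : ∀ N T E F x → N * x * T - E * (N * F) ≡ N * (x * T - E * F)
  ab′-identity = solve-∀

  -- Since `form D A + 1` = D A² - 1, the reflected value is A (D A B - x) - B, hence congruent to
  -- -B modulo A.
  bézout-identity : ∀ D A B x s t →
    (s + t * (D * A * B - x)) * A + - t * (B * (D * (A * A) - + 2 + + 1) - A * x) ≡ s * A + t * B
  bézout-identity = solve-∀

  -- With form D A = e u² and form D B = e v², this multiplies B √D + v √e by the
  -- unit (A √D - u √e)² / 2.
  descend : ∀ {D N A B} (L : Linked D N A B) → Linked D N A (reflect D A B (x L))
  descend {D} {N} {A} {B} L = record
    { a = a L
    ; b = b L * T - E * a L
    ; x = x L * T - E * F
    ; s = s L + t L * (E - x L)
    ; t = - t L
    ; a² = a² L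
    ; b² = begin
        (b L * T - E * a L) * (b L * T - E * a L)
          ≡⟨ b′²-expand T E (a L) (b L) ⟩
        b L * b L * (T * T) - + 2 * E * T * (a L * b L) + E * E * (a L * a L)
          ≡⟨ cong₂ (λ u v → u * (T * T) - + 2 * E * T * v + E * E * (a L * a L)) (b² L) (ab L) ⟩
        N * form D B * (T * T) - + 2 * E * T * (N * x L) + E * E * (a L * a L)
          ≡⟨ cong (λ u → N * form D B * (T * T) - + 2 * E * T * (N * x L) + E * E * u) (a² L) ⟩
        N * form D B * (T * T) - + 2 * E * T * (N * x L) + E * E * (N * F)
          ≡⟨ +-cancel (b′²-identity D A B N (x L)) (cong (λ u → N * (D * (A * A * u))) (x² L)) ⟩
        N * form D (reflect D A B (x L)) ∎
    ; x² = +-cancel (x′²-identity D A B (x L)) (sym (x² L))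
    ; ab = begin
        a L * (b L * T - E * a L)         ≡⟨ ab′-expand T E (a L) (b L) ⟩
        a L * b L * T - E * (a L * a L)   ≡⟨ cong₂ (λ u v → u * T - E * v) (ab L) (a² L) ⟩
        N * x L * T - E * (N * F)         ≡⟨ ab′-identity N T E F (x L) ⟩
        N * (x L * T - E * F)             ∎
    ; bézout = trans (bézout-identity D A B (x L) (s L) (t L)) (bézout L)
    }
    where
    open ≡-Reasoning
    F = form D A
    T = F + + 1
    E = D * A * B

  descend-< : ∀ {D N A B} → + 2 < D → 0ℤ < A → A < B → Linked D N A B →
    ∃ λ B′ → 0ℤ < B′ × B′ < B × Linked D N A B′
  descend-< 2<D 0<A A<B L with reflect-< (x L) 2<D 0<A A<B (x² L)
  ... | inj₁ B′<B = _ , reflect-pos (x L) 2<D 0<A (<-trans 0<A A<B) (x² L) , B′<B , descend L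
  ... | inj₂ B′<B =
    _ , reflect-pos (- x L) 2<D 0<A (<-trans 0<A A<B) (x² (negate L)) , B′<B , descend (negate L)

  -- The Euclidean algorithm.

  coprime-diagonal : ∀ {A s t} → 0ℤ < A → s * A + t * A ≡ 1ℤ → A ≡ 1ℤ
  coprime-diagonal {+ A} {s} {t} 0<A eq = cong +_ (ℕ.m*n≡1⇒n≡1 ∣ s + t ∣ A (begin
    ∣ s + t ∣ ℕ.* A         ≡⟨ abs-* (s + t) (+ A) ⟨
    ∣ (s + t) * + A ∣       ≡⟨ cong ∣_∣ (*-distribʳ-+ (+ A) s t) ⟩
    ∣ s * + A + t * + A ∣   ≡⟨ cong ∣_∣ eq ⟩
    1                       ∎))
    where open ≡-Reasoning

  -- f is fuel for the descent on A + B.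
  euclid : ∀ f {D N A B} → + 2 < D → 0ℤ < A → 0ℤ < B → A + B ≤ + f → Linked D N A B →
    ∃ λ a → a * a ≡ N * form D 1ℤ
  euclid f {A = A} {B} 2<D 0<A 0<B A+B≤f L with <-cmp A B
  euclid f {D} {N} 2<D 0<A 0<B A+B≤f L | tri≈ _ refl _ =
    -- The descent stops only at `A = B`, where coprimality forces 1; `N` has stayed fixed
    -- throughout.
    a L , trans (a² L) (cong (λ A → N * form D A) (coprime-diagonal {s = s L} {t = t L} 0<A (bézout L)))
  euclid zero 2<D 0<A 0<B A+B≤0 L | tri< _ _ _ =
    contradiction A+B≤0 (<⇒≱ (+-mono-< 0<A 0<B))
  euclid zero 2<D 0<A 0<B A+B≤0 L | tri> _ _ _ =
    contradiction A+B≤0 (<⇒≱ (+-mono-< 0<A 0<B))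
  euclid (suc f) {A = A} 2<D 0<A 0<B A+B≤f L | tri< A<B _ _ =
    let B′ , 0<B′ , B′<B , L′ = descend-< 2<D 0<A A<B L
    in euclid f 2<D 0<A 0<B′ (i<j⇒i≤pred[j] (<-≤-trans (+-monoʳ-< A B′<B) A+B≤f)) L′
  euclid (suc f) {B = B} 2<D 0<A 0<B A+B≤f L | tri> _ _ B<A =
    let A′ , 0<A′ , A′<A , L′ = descend-< 2<D 0<B B<A (swap L)
    in euclid f 2<D 0<B 0<A′ (i<j⇒i≤pred[j] (<-≤-trans (subst (B + A′ <_) (+-comm B _) (+-monoʳ-< B A′<A)) A+B≤f)) L′

  -- Powers and coprimality.

  pos-^ : ∀ a n → + (a ℕ.^ n) ≡ (+ a) ^ n
  pos-^ a zero    = refl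
  pos-^ a (suc n) = trans (pos-* a (a ℕ.^ n)) (cong (+ a *_) (pos-^ a n))

  Coprime : ℤ → ℤ → Set
  Coprime i j = ∃ λ s → ∃ λ t → s * i + t * j ≡ 1ℤ

  coprime-sym : ∀ {i j} → Coprime i j → Coprime j i
  coprime-sym {i} {j} (s , t , eq) = t , s , trans (+-comm (t * j) (s * i)) eq

  coprime-* : ∀ {i j k} → Coprime i k → Coprime j k → Coprime (i * j) k
  coprime-* {i} {j} {k} (s , t , eq) (s′ , t′ , eq′) =
    -- Coefficients of the product of the two Bézout relations.
    s * s′ , s * i * t′ + t * (s′ * j + t′ * k) ,
    trans (expand i j k s t s′ t′) (cong₂ _*_ eq eq′)
    where
    expand : ∀ i j k s t s′ t′ →
      s * s′ * (i * j) + (s * i * t′ + t * (s′ * j + t′ * k)) * k ≡ (s * i + t * k) * (s′ * j + t′ * k)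
    expand = solve-∀

  coprime-^ : ∀ {a k} n → Coprime (+ a) k → Coprime (+ (a ℕ.^ n)) k
  coprime-^ zero coprime = 1ℤ , 0ℤ , refl
  coprime-^ {a} {k} (suc n) coprime =
    subst (λ i → Coprime i k) (sym (pos-* a (a ℕ.^ n))) (coprime-* coprime (coprime-^ n coprime))

  -- Even exponents from 8 on.

  no-root : ∀ E W k → 2 ℕ.≤ E → 4 ℕ.* W ℕ.+ 3 ℕ.* E ℕ.< 2 ℕ.* (E ℕ.* E) ℕ.* E →
    9 ℕ.* (E ℕ.* E) ℕ.≤ 4 ℕ.* W → 0ℤ < k → k < + W →
    let D = + (E ℕ.* E); F = form D 1ℤ in
    k * k + + W * + W + + 2 * (1ℤ * 1ℤ) * F ≢ + 2 * (F + + 1) * + W * k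
  -- With F = D - 2, the terms -4 and -2Wk change sides, giving the subtraction-free equation of
  -- `small-root-absurd`.
  no-root E W (+ k) 2≤E h₁ h₂ (+<+ 0<k) (+<+ k<W) eq =
    small-root-absurd E W k 0<k k<W 2≤E h₁ h₂ (+-injective (begin
      + (k ℕ.* k ℕ.+ W ℕ.* W ℕ.+ 2 ℕ.* D ℕ.+ 2 ℕ.* W ℕ.* k)
        ≡⟨ cong₂ _+_ (cong₂ _+_ (cong₂ _+_ (pos-* k k) (pos-* W W)) (pos-* 2 D)) (pos-*₃ 2 W k) ⟩
      + k * + k + + W * + W + + 2 * + D + + 2 * + W * + k
        ≡⟨ +-cancel (rearrange (+ D) (+ W) (+ k)) (sym eq) ⟩
      + 2 * + D * + W * + k + + 4
        ≡⟨ cong (_+ + 4) (trans (cong (_* + k) (sym (pos-*₃ 2 D W))) (sym (pos-* (2 ℕ.* D ℕ.* W) k))) ⟩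
      + (2 ℕ.* D ℕ.* W ℕ.* k ℕ.+ 4) ∎))
    where
    open ≡-Reasoning
    D = E ℕ.* E
    pos-*₃ : ∀ i j k → + (i ℕ.* j ℕ.* k) ≡ + i * + j * + k
    pos-*₃ i j k = trans (pos-* (i ℕ.* j) k) (cong (_* + k) (pos-* i j))
    rearrange : ∀ D W k → let F = D * (1ℤ * 1ℤ) - + 2 in
      k * k + W * W + + 2 * D + + 2 * W * k + + 2 * (F + + 1) * W * k
        ≡ + 2 * D * W * k + + 4 + (k * k + W * W + + 2 * (1ℤ * 1ℤ) * F)
    rearrange = solve-∀

  -- From one exponent to the next, the sides of the second estimate grow by factors of at most 5
  -- and exactly 8, those of the third by 4 and 5.
  growth : ∀ i → let W = 5 ℕ.^ (i ℕ.+ 4); E = 2 ℕ.^ (i ℕ.+ 4) in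
    2 ℕ.≤ E × 4 ℕ.* W ℕ.+ 3 ℕ.* E ℕ.< 2 ℕ.* (E ℕ.* E) ℕ.* E × 9 ℕ.* (E ℕ.* E) ℕ.≤ 4 ℕ.* W
  -- Here W = 625 and E = 16. At exponent 3 the last estimate fails, since 576 > 500.
  growth zero = from-yes (2 ℕ.≤? 16) , from-yes (2548 ℕ.<? 8192) , from-yes (2304 ℕ.≤? 2500)
  growth (suc i) with growth i
  ... | h₀ , h₁ , h₂ = ℕ.≤-trans h₀ (ℕ.m≤m+n E _) , (begin-strict
      4 ℕ.* (5 ℕ.* W) ℕ.+ 3 ℕ.* (2 ℕ.* E)               ≤⟨ ℕ.m≤m+n _ (9 ℕ.* E) ⟩
      4 ℕ.* (5 ℕ.* W) ℕ.+ 3 ℕ.* (2 ℕ.* E) ℕ.+ 9 ℕ.* E   ≡⟨ factor W E ⟩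
      5 ℕ.* (4 ℕ.* W ℕ.+ 3 ℕ.* E)                       <⟨ ℕ.*-monoʳ-< 5 h₁ ⟩
      5 ℕ.* E³                                          ≤⟨ ℕ.*-monoˡ-≤ E³ (ℕ.m≤m+n 5 3) ⟩
      8 ℕ.* E³                                          ≡⟨ cube E ⟩
      2 ℕ.* (2 ℕ.* E ℕ.* (2 ℕ.* E)) ℕ.* (2 ℕ.* E)       ∎) , (begin
      9 ℕ.* (2 ℕ.* E ℕ.* (2 ℕ.* E))                     ≡⟨ square E ⟩
      4 ℕ.* (9 ℕ.* (E ℕ.* E))                           ≤⟨ ℕ.*-mono-≤ (ℕ.n≤1+n 4) h₂ ⟩
      5 ℕ.* (4 ℕ.* W)                                   ≡⟨ commute W ⟩
      4 ℕ.* (5 ℕ.* W)                                   ∎)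
    where
    open ℕ.≤-Reasoning
    W = 5 ℕ.^ (i ℕ.+ 4)
    E = 2 ℕ.^ (i ℕ.+ 4)
    E³ = 2 ℕ.* (E ℕ.* E) ℕ.* E
    factor : ∀ W E → 4 ℕ.* (5 ℕ.* W) ℕ.+ 3 ℕ.* (2 ℕ.* E) ℕ.+ 9 ℕ.* E ≡ 5 ℕ.* (4 ℕ.* W ℕ.+ 3 ℕ.* E)
    factor = ℕ.solve-∀
    cube : ∀ E → 8 ℕ.* (2 ℕ.* (E ℕ.* E) ℕ.* E) ≡ 2 ℕ.* (2 ℕ.* E ℕ.* (2 ℕ.* E)) ℕ.* (2 ℕ.* E)
    cube = ℕ.solve-∀
    square : ∀ E → 9 ℕ.* (2 ℕ.* E ℕ.* (2 ℕ.* E)) ≡ 4 ℕ.* (9 ℕ.* (E ℕ.* E))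
    square = ℕ.solve-∀
    commute : ∀ W → 5 ℕ.* (4 ℕ.* W) ≡ 4 ℕ.* (5 ℕ.* W)
    commute = ℕ.solve-∀

  even-^ : ∀ c m → (+ (2 ℕ.* c)) ^ (m ℕ.* 2) ≡ + (2 ℕ.^ m ℕ.* 2 ℕ.^ m) * (+ (c ℕ.^ m) * + (c ℕ.^ m))
  even-^ c m = begin
    (+ (2 ℕ.* c)) ^ (m ℕ.* 2)     ≡⟨ pos-^ (2 ℕ.* c) (m ℕ.* 2) ⟨
    + ((2 ℕ.* c) ℕ.^ (m ℕ.* 2))   ≡⟨ cong +_ (split m) ⟩
    + (E ℕ.* E ℕ.* (C ℕ.* C))     ≡⟨ pos-* (E ℕ.* E) (C ℕ.* C) ⟩
    + (E ℕ.* E) * + (C ℕ.* C)     ≡⟨ cong (+ (E ℕ.* E) *_) (pos-* C C) ⟩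
    + (E ℕ.* E) * (+ C * + C)     ∎
    where
    open ≡-Reasoning
    E = 2 ℕ.^ m
    C = c ℕ.^ m
    interchange : ∀ c e w → 2 ℕ.* c ℕ.* (2 ℕ.* c ℕ.* (e ℕ.* e ℕ.* (w ℕ.* w)))
      ≡ 2 ℕ.* e ℕ.* (2 ℕ.* e) ℕ.* (c ℕ.* w ℕ.* (c ℕ.* w))
    interchange = ℕ.solve-∀
    split : ∀ m → (2 ℕ.* c) ℕ.^ (m ℕ.* 2) ≡ 2 ℕ.^ m ℕ.* 2 ℕ.^ m ℕ.* (c ℕ.^ m ℕ.* c ℕ.^ m)
    split zero    = refl
    split (suc m) = trans (cong (λ r → 2 ℕ.* c ℕ.* (2 ℕ.* c ℕ.* r)) (split m))
      (interchange c (2 ℕ.^ m) (c ℕ.^ m))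

  large-even-absurd : ∀ i x → let m = i ℕ.+ 4 in
    ((+ 10) ^ (m ℕ.* 2) - + 2) * ((+ 58) ^ (m ℕ.* 2) - + 2) ≢ x * x
  large-even-absurd i x eq =
    let s , t , bézout = coprime
        -- Taking w = u in `Linked` gives N = a = `form D W` and b = x, so the descent makes
        -- `form D W * form D 1ℤ` a square.
        a , a² = euclid (5 ℕ.^ m ℕ.+ 29 ℕ.^ m) {D} {form D W} {W} {V} 2<D 0<W 0<V ≤-refl (record
          { a = form D W ; b = x ; x = x ; s = s ; t = t
          ; a² = refl ; b² = square ; x² = square ; ab = refl ; bézout = bézout })
    in no-reflection a (trans a² (*-comm (form D W) (form D 1ℤ)))
    where
    m = i ℕ.+ 4
    D = + (2 ℕ.^ m ℕ.* 2 ℕ.^ m)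
    W = + (5 ℕ.^ m)
    V = + (29 ℕ.^ m)
    coprime : Coprime W V
    -- The witnesses express -29 + 6 · 5 = 1.
    coprime = coprime-^ m (coprime-sym {+ (29 ℕ.^ m)} (coprime-^ m (-1ℤ , + 6 , refl)))
    2<D : + 2 < D
    2<D = +<+ (ℕ.≤-trans (ℕ.n≤1+n 3) (ℕ.*-mono-≤ (proj₁ (growth i)) (proj₁ (growth i))))
    0<W : 0ℤ < W
    0<W = +<+ (ℕ.m^n>0 5 m)
    0<V : 0ℤ < V
    0<V = +<+ (ℕ.m^n>0 29 m)
    1<W : 1ℤ < W
    1<W = +<+ (subst (1 ℕ.<_) (sym (ℕ.^-distribˡ-+-* 5 i 4))
      (ℕ.*-mono-≤ (ℕ.m^n>0 5 i) (from-yes (2 ℕ.≤? 625))))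
    square : x * x ≡ form D W * form D V
    square = sym (subst₂ (λ u v → (u - + 2) * (v - + 2) ≡ x * x) (even-^ 5 m) (even-^ 29 m) eq)
    reflect-≮ : ∀ a → a * a ≡ form D 1ℤ * form D W → ¬ reflect D 1ℤ W a < W
    reflect-≮ a a² k<W =
      let h₀ , h₁ , h₂ = growth i
      in no-root (2 ℕ.^ m) (5 ℕ.^ m) (reflect D 1ℤ W a) h₀ h₁ h₂
           (reflect-pos {D} {1ℤ} {W} a 2<D (+<+ ℕ.z<s) 0<W a²) k<W (reflect-quadratic D 1ℤ W a a²)
    no-reflection : ∀ a → a * a ≢ form D 1ℤ * form D W
    -- Either sign of `a` may give the root below `W`.
    no-reflection a a² with reflect-< {D} {1ℤ} {W} a 2<D (+<+ ℕ.z<s) 1<W a²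
    ... | inj₁ k<W = reflect-≮ a a² k<W
    ... | inj₂ k<W = reflect-≮ (- a) (trans (neg-square a) a²) k<W

  -- Case distinction on the exponent.

  toSolution : ∀ n x → ((+ 10) ^ n - + 2) * ((+ 58) ^ n - + 2) ≡ (+ x) ^ 2 → Solution n x
  toSolution n x eq = +-injective (begin
    + (x ℕ.* x ℕ.+ 2 ℕ.* u ℕ.+ 2 ℕ.* v)
      ≡⟨ cong₂ _+_ (cong₂ _+_ (pos-* x x) (pos-* 2 u)) (pos-* 2 v) ⟩
    + x * + x + + 2 * + u + + 2 * + v
      ≡⟨ +-cancel (rearrange (+ u) (+ v) (+ x))
           (subst₂ (λ u v → (u - + 2) * (v - + 2) ≡ (+ x) ^ 2) (sym (pos-^ 10 n)) (sym (pos-^ 58 n)) eq) ⟩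
    + u * + v + + 4
      ≡⟨ cong (_+ + 4) (pos-* u v) ⟨
    + (u ℕ.* v ℕ.+ 4) ∎)
    where
    open ≡-Reasoning
    u = 10 ℕ.^ n
    v = 58 ℕ.^ n
    rearrange : ∀ u v x → x * x + + 2 * u + + 2 * v + (u - + 2) * (v - + 2) ≡ u * v + + 4 + x * (x * 1ℤ)
    rearrange = solve-∀

  halve : ∀ n → ∃ λ m → n ≡ m ℕ.* 2 ⊎ n ≡ suc (m ℕ.* 2)
  halve zero = 0 , inj₁ refl
  halve (suc n) with halve n
  ... | m , inj₁ eq = m , inj₂ (cong suc eq)
  ... | m , inj₂ eq = suc m , inj₁ (cong suc eq)

  square-injective : ∀ {x y} → x ℕ.* x ≡ y ℕ.* y → x ≡ y
  square-injective {x} {y} eq with ℕ.<-cmp x y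
  ... | tri< x<y _ _ = contradiction eq (ℕ.<⇒≢ (ℕ.*-mono-< x<y x<y))
  ... | tri≈ _ x≡y _ = x≡y
  ... | tri> _ _ y<x = contradiction (sym eq) (ℕ.<⇒≢ (ℕ.*-mono-< y<x y<x))

  solutions : ∀ n x → 2 ℕ.≤ n → ((+ 10) ^ n - + 2) * ((+ 58) ^ n - + 2) ≡ (+ x) ^ 2 →
    (n , x) ≡ (2 , 574)
  solutions n x 2≤n eq with halve n
  solutions n x 2≤n eq | m , inj₂ refl = contradiction (toSolution n x eq) (odd-¬Solution m x)
  solutions n x () eq | 0 , inj₁ refl
  solutions n x 2≤n eq | 1 , inj₁ refl = cong (2 ,_) (square-injective
    -- 200 = 2 · 10² and 6728 = 2 · 58² are the terms that `Solution` adds to x².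
    (ℕ.+-cancelʳ-≡ 200 (x ℕ.* x) (574 ℕ.* 574)
      (ℕ.+-cancelʳ-≡ 6728 (x ℕ.* x ℕ.+ 200) (574 ℕ.* 574 ℕ.+ 200) (toSolution 2 x eq))))
  solutions n x 2≤n eq | 2 , inj₁ refl =
    contradiction (toSolution 4 x eq) (excluded-¬Solution 3 x (inj₂ (inj₁ refl)))
  solutions n x 2≤n eq | 3 , inj₁ refl =
    contradiction (toSolution 6 x eq) (excluded-¬Solution 5 x (inj₂ (inj₂ refl)))
  solutions n x 2≤n eq | suc (suc (suc (suc i))) , inj₁ refl = contradiction
    (subst (λ m → ((+ 10) ^ (m ℕ.* 2) - + 2) * ((+ 58) ^ (m ℕ.* 2) - + 2) ≡ + x * + x) (ℕ.+-comm 4 i)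
      (trans eq (cong (+ x *_) (*-identityʳ (+ x)))))
    (large-even-absurd i (+ x))

open import Defs
open import Data.Nat.Base using (ℕ; _≤_)
open import Data.Integer.Base using (+_; _-_; _*_; _^_)

theorem29 : ∀ (n x : ℕ) → 2 ≤ n → 1 ≤ x →
    ((+ 10) ^ n - + 2) * ((+ 58) ^ n - + 2) ≡ (+ x) ^ 2 ⇔ (n , x) ≡ (2 , 574)
theorem29 n x 2≤n _ = mk⇔ (Integers.solutions n x 2≤n) λ { refl → refl }
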